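{- Let $w\in\{\mathtt a,\mathtt b\}^n$. Then the cardinality of the $\sim_2$-class of $w$ in $\{\mathtt a,\mathtt b\}^n$ is $$\#[w]_{\sim_2}=[q^{\binom{w}{\mathtt{ab}}}]\binom{n}{|w|_{\mathtt a}}_{\!q}.$$
   Context: $|w|_{\mathtt a}$ is the number of letters $\mathtt a$ in $w$ and $\binom{w}{\mathtt{ab}}$ the number of occurrences of $\mathtt{ab}$ as a scattered subword of $w$. For $u,w\in\{\mathtt a,\mathtt b\}^n$, $u\sim_2w$ iff $|u|_{\mathtt a}=|w|_{\mathtt a}$ and $\binom{u}{\mathtt{ab}}=\binom{w}{\mathtt{ab}}$. The Gaussian binomial coefficient is the polynomial $\binom{c}{d}_q=\prod_{i=1}^d\frac{1-q^{c-d+i}}{1-q^i}$ for $0\le d\le c$; $[q^k]f$ is the coefficient of $q^k$ in $f$. -}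

module Defs where

open import Data.Nat as ℕ using (ℕ; zero; suc; _∸_)
open import Data.Integer using (ℤ; +_; 0ℤ; 1ℤ; _+_; _-_; _*_)
import Data.Integer.Properties as ℤ
open import Data.Integer.Tactic.RingSolver using (solve-∀)
open import Data.Fin using (Fin; _<_; _<?_)
open import Data.List using (List; length; filter; allFin; cartesianProduct)
open import Data.Product using (∃; _×_; _,_)
open import Data.Vec using (Vec; lookup; count)
open import Function.Bundles using (_↔_)
open import Relation.Binary.Definitions using (DecidableEquality)
open import Relation.Binary.PropositionalEquality
open import Relation.Nullary using (Dec; yes; no)
open import Relation.Nullary.Decidable using (_×-dec_)

data Letter : Set where
  𝚊 𝚋 : Letter

_≟_ : DecidableEquality Letter
𝚊 ≟ 𝚊 = yes refl
𝚊 ≟ 𝚋 = no λ ()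
𝚋 ≟ 𝚊 = no λ ()
𝚋 ≟ 𝚋 = yes refl

Word : ℕ → Set
Word n = Vec Letter n

∣_∣𝚊 : ∀ {n} → Word n → ℕ
∣ w ∣𝚊 = count (_≟ 𝚊) w

-- An occurrence of 𝚊𝚋 as a scattered subword is a pair of positions i < j
-- carrying the letters 𝚊 and 𝚋 respectively.
Occurs𝚊𝚋 : ∀ {n} → Word n → Fin n × Fin n → Set
Occurs𝚊𝚋 w (i , j) = i < j × lookup w i ≡ 𝚊 × lookup w j ≡ 𝚋

occurs𝚊𝚋? : ∀ {n} (w : Word n) (p : Fin n × Fin n) → Dec (Occurs𝚊𝚋 w p)
occurs𝚊𝚋? w (i , j) = (i <? j) ×-dec ((lookup w i ≟ 𝚊) ×-dec (lookup w j ≟ 𝚋))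

∣_∣𝚊𝚋 : ∀ {n} → Word n → ℕ
∣_∣𝚊𝚋 {n} w = length (filter (occurs𝚊𝚋? w) (cartesianProduct (allFin n) (allFin n)))

infix 4 _∼₂_

_∼₂_ : ∀ {n} → Word n → Word n → Set
u ∼₂ w = ∣ u ∣𝚊 ≡ ∣ w ∣𝚊 × ∣ u ∣𝚊𝚋 ≡ ∣ w ∣𝚊𝚋

-- ∼₂ is a conjunction of equations in ℕ, hence proof-irrelevant, so the
-- elements of this type are exactly the words in the class of w.
[_]∼₂ : ∀ {n} → Word n → Set
[ w ]∼₂ = ∃ λ u → u ∼₂ w

HasCardinality : Set → ℕ → Set
HasCardinality A m = Fin m ↔ A

-- The quotients defining Gaussian binomials are taken in ℤ[[q]], where every
-- 1 - q^i with i ≥ 1 is a unit; a series is its sequence of coefficients.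
-- A polynomial is a series with finitely many nonzero coefficients.
Series : Set
Series = ℕ → ℤ

infix 5 [q^_]_

[q^_]_ : ℕ → Series → ℤ
[q^ k ] f = f k

tail : Series → Series
tail f k = f (suc k)

q^_ : ℕ → Series
(q^ zero)  zero    = 1ℤ
(q^ zero)  (suc k) = 0ℤ
(q^ suc i) zero    = 0ℤ
(q^ suc i) (suc k) = (q^ i) k

𝟙 : Series
𝟙 = q^ 0

infixl 6 _⊖_
infixl 7 _⊛_

_⊖_ : Series → Series → Series
(f ⊖ g) k = f k - g k

-- The Cauchy product, (f ⊛ g) k = Σ_{i ≤ k} f i * g (k - i).
_⊛_ : Series → Series → Series
(f ⊛ g) zero    = f 0 * g 0
(f ⊛ g) (suc k) = f 0 * g (suc k) + (tail f ⊛ g) k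

-- Long division by a series with constant term 1; see quotient-⊛.
quotient : (f g : Series) → .(g 0 ≡ 1ℤ) → Series
quotient f g g₀≡1 zero    = f 0
quotient f g g₀≡1 (suc k) = quotient (λ i → f (suc i) - f 0 * g (suc i)) g g₀≡1 k

quotient-⊛ : ∀ f g (g₀≡1 : g 0 ≡ 1ℤ) k → (quotient f g g₀≡1 ⊛ g) k ≡ f k
quotient-⊛ f g g₀≡1 zero = trans (cong (f 0 *_) g₀≡1) (ℤ.*-identityʳ (f 0))
quotient-⊛ f g g₀≡1 (suc k) =
  trans (cong (_+_ (f 0 * g (suc k))) (quotient-⊛ _ g g₀≡1 k))
        (cancel (f 0 * g (suc k)) (f (suc k)))
  where
  cancel : ∀ x y → x + (y - x) ≡ y
  cancel = solve-∀

-- ∏ d F is the product of F i over 0 ≤ i < d.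
∏ : ℕ → (ℕ → Series) → Series
∏ zero    F = 𝟙
∏ (suc d) F = ∏ d F ⊛ F d

-- ∏_{i=1}^{d} (1 - q^{c-d+i}) / (1 - q^i), with i written as suc j.
-- Meaningful for d ≤ c, where c ∸ d is the true difference.
gaussianBinomial : ℕ → ℕ → Series
gaussianBinomial c d =
  ∏ d λ j → quotient (𝟙 ⊖ q^ ((c ∸ d) ℕ.+ suc j)) (𝟙 ⊖ q^ (suc j)) refl

module Submission where

open import Defs
import Algebra.Properties.AbelianGroup as AbelianGroupProperties
open import Algebra.Bundles using (CommutativeSemigroup)
import Algebra.Properties.CommutativeSemigroup as CommutativeSemigroupProperties
open import Data.Bool using (true; false)
open import Data.Empty using (⊥-elim)
open import Data.Fin as Fin using (Fin; zero; suc)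
open import Data.Fin.Properties using (+↔⊎)
open import Data.Integer using (ℤ; +_; 0ℤ; 1ℤ; _+_; _-_; _*_)
import Data.Integer.Properties as ℤ
open import Data.Integer.Tactic.RingSolver using (solve-∀)
open import Data.List as List using ([]; _∷_; _++_; length; filter; allFin; cartesianProduct)
import Data.List.Properties as List
import Data.List.Relation.Unary.All as All
open import Data.Nat as ℕ using (ℕ; zero; suc; _∸_; _≤_; _<_; z<s; s<s; s<s⁻¹; s≤s⁻¹)
import Data.Nat.Properties as ℕ
open import Data.Product using (∃; _×_; _,_; proj₁; proj₂; map₁)
open import Data.Sum using (_⊎_; inj₁; inj₂)
open import Data.Sum.Function.Propositional using (_⊎-↔_)
open import Data.Vec using (lookup; []; _∷_)
import Data.Vec.Properties as Vec
open import Function using (_∘_)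
open import Function.Bundles using (_↔_; mk↔ₛ′)
open import Function.Properties.Inverse using (↔-trans)
open import Level using (Level)
open import Relation.Binary.Bundles using (Setoid)
open import Relation.Binary.PropositionalEquality
import Relation.Binary.Reasoning.Setoid as SetoidReasoning
open import Relation.Nullary using (¬_; does)
open import Relation.Unary using (Pred; Decidable)

-- Splitting off the first letter shows that the words with d letters 𝚊 and
-- e letters 𝚋, counted by occurrences of 𝚊𝚋, satisfy the q-Pascal recursion
--   [e+d+2 choose d+1] = [e+d+1 choose d+1] + q^(e+1) [e+d+1 choose d],
-- because a leading 𝚊 adds one occurrence for every 𝚋 after it and a leading 𝚋
-- adds none. The product formula satisfies the same recursion: since the
-- factors 1 - q^i with i ≥ 1 are cancellable in ℤ[[q]], this reduces to
-- 1 - q^(i+j) = (1 - q^i) + q^i (1 - q^j).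

-- Commutative semigroup of power series under the Cauchy product.

infixl 6 _⊕_

_⊕_ : Series → Series → Series
(f ⊕ g) k = f k + g k

𝟘 : Series
𝟘 k = 0ℤ

⊛-cong : ∀ {f f′ g g′} → f ≗ f′ → g ≗ g′ → f ⊛ g ≗ f′ ⊛ g′
⊛-cong p q zero    = cong₂ _*_ (p 0) (q 0)
⊛-cong p q (suc k) =
  cong₂ _+_ (cong₂ _*_ (p 0) (q (suc k))) (⊛-cong (λ i → p (suc i)) q k)

⊛-zeroˡ : ∀ f → 𝟘 ⊛ f ≗ 𝟘
⊛-zeroˡ f zero    = ℤ.*-zeroˡ (f 0)
⊛-zeroˡ f (suc k) = cong₂ _+_ (ℤ.*-zeroˡ (f (suc k))) (⊛-zeroˡ f k)

⊛-identityˡ : ∀ f → 𝟙 ⊛ f ≗ f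
⊛-identityˡ f zero    = ℤ.*-identityˡ (f 0)
⊛-identityˡ f (suc k) = trans
  (cong₂ _+_ (ℤ.*-identityˡ (f (suc k))) (⊛-zeroˡ f k))
  (ℤ.+-identityʳ (f (suc k)))

-- The definition of `⊛` splits off the first summand. Swapping the factors reverses the sum, so
-- commutativity also needs the last summand split off.
⊛-suc-last : ∀ f g k → (f ⊛ g) (suc k) ≡ (f ⊛ tail g) k + f (suc k) * g 0
⊛-suc-last f g zero    = refl
⊛-suc-last f g (suc k) = trans
  (cong (_+_ (f 0 * g (suc (suc k)))) (⊛-suc-last (tail f) g k))
  (sym (ℤ.+-assoc (f 0 * g (suc (suc k))) _ _))

⊛-comm : ∀ f g → f ⊛ g ≗ g ⊛ f
⊛-comm f g zero    = ℤ.*-comm (f 0) (g 0)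
⊛-comm f g (suc k) = begin
  f 0 * g (suc k) + (tail f ⊛ g) k  ≡⟨ cong₂ _+_ (ℤ.*-comm (f 0) (g (suc k))) (⊛-comm (tail f) g k) ⟩
  g (suc k) * f 0 + (g ⊛ tail f) k  ≡⟨ ℤ.+-comm (g (suc k) * f 0) _ ⟩
  (g ⊛ tail f) k + g (suc k) * f 0  ≡⟨ ⊛-suc-last g f k ⟨
  (g ⊛ f) (suc k)                   ∎
  where open ≡-Reasoning

⊛-distribʳ-⊕ : ∀ h f g → (f ⊕ g) ⊛ h ≗ f ⊛ h ⊕ g ⊛ h
⊛-distribʳ-⊕ h f g zero    = ℤ.*-distribʳ-+ (h 0) (f 0) (g 0)
⊛-distribʳ-⊕ h f g (suc k) = trans
  (cong (_+_ ((f 0 + g 0) * h (suc k))) (⊛-distribʳ-⊕ h (tail f) (tail g) k))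
  (regroup (f 0) (g 0) (h (suc k)) _ _)
  where
  regroup : ∀ x y z s t → (x + y) * z + (s + t) ≡ (x * z + s) + (y * z + t)
  regroup = solve-∀

⊛-scaleˡ : ∀ c f g k → ((λ i → c * f i) ⊛ g) k ≡ c * (f ⊛ g) k
⊛-scaleˡ c f g zero    = ℤ.*-assoc c (f 0) (g 0)
⊛-scaleˡ c f g (suc k) = trans
  (cong (_+_ (c * f 0 * g (suc k))) (⊛-scaleˡ c (tail f) g k))
  (factor c (f 0) (g (suc k)) _)
  where
  factor : ∀ c x y s → c * x * y + c * s ≡ c * (x * y + s)
  factor = solve-∀

⊛-assoc : ∀ f g h → (f ⊛ g) ⊛ h ≗ f ⊛ (g ⊛ h)
⊛-assoc f g h zero    = ℤ.*-assoc (f 0) (g 0) (h 0)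
⊛-assoc f g h (suc k) = begin
  -- `tail (f ⊛ g)` unfolds to `f 0` times `tail g`, plus `tail f ⊛ g`.
  f 0 * g 0 * h (suc k) + (((λ i → f 0 * g (suc i)) ⊕ tail f ⊛ g) ⊛ h) k
    ≡⟨ cong (_+_ (f 0 * g 0 * h (suc k))) (⊛-distribʳ-⊕ h (λ i → f 0 * g (suc i)) (tail f ⊛ g) k) ⟩
  f 0 * g 0 * h (suc k) + (((λ i → f 0 * g (suc i)) ⊛ h) k + ((tail f ⊛ g) ⊛ h) k)
    ≡⟨ cong (_+_ (f 0 * g 0 * h (suc k))) (cong₂ _+_ (⊛-scaleˡ (f 0) (tail g) h k) (⊛-assoc (tail f) g h k)) ⟩
  f 0 * g 0 * h (suc k) + (f 0 * (tail g ⊛ h) k + (tail f ⊛ (g ⊛ h)) k)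
    ≡⟨ factor (f 0) (g 0) (h (suc k)) _ _ ⟩
  f 0 * (g 0 * h (suc k) + (tail g ⊛ h) k) + (tail f ⊛ (g ⊛ h)) k ∎
  where
  open ≡-Reasoning
  factor : ∀ x y z s t → x * y * z + (x * s + t) ≡ x * (y * z + s) + t
  factor = solve-∀

⊛-commutativeSemigroup : CommutativeSemigroup _ _
⊛-commutativeSemigroup = record
  { Carrier = Series
  ; _≈_     = _≗_
  ; _∙_     = _⊛_
  ; isCommutativeSemigroup = record
    { isSemigroup = record
      { isMagma = record
        { isEquivalence = Setoid.isEquivalence (ℕ →-setoid ℤ)
        ; ∙-cong = ⊛-cong
        }
      ; assoc = ⊛-assoc
      }
    ; comm = ⊛-comm
    }
  }

open CommutativeSemigroup ⊛-commutativeSemigroup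
  using ()
  renaming (∙-congˡ to ⊛-congˡ; ∙-congʳ to ⊛-congʳ;
            sym to ≗-sym; trans to ≗-trans)
open CommutativeSemigroupProperties ⊛-commutativeSemigroup using (xy∙z≈xz∙y)

-- Coefficients are recovered one at a time: `h 0 ≡ 1ℤ` gives equality of the constant terms, and
-- subtracting their contribution leaves the same hypothesis for the tails.
⊛-cancelʳ : ∀ f g h → h 0 ≡ 1ℤ → f ⊛ h ≗ g ⊛ h → f ≗ g
⊛-cancelʳ f g h h₀≡1 p zero = begin
  f 0        ≡⟨ ℤ.*-identityʳ (f 0) ⟨
  f 0 * 1ℤ   ≡⟨ cong (f 0 *_) h₀≡1 ⟨
  f 0 * h 0  ≡⟨ p 0 ⟩
  g 0 * h 0  ≡⟨ cong (g 0 *_) h₀≡1 ⟩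
  g 0 * 1ℤ   ≡⟨ ℤ.*-identityʳ (g 0) ⟩
  g 0        ∎
  where open ≡-Reasoning
⊛-cancelʳ f g h h₀≡1 p (suc k) = ⊛-cancelʳ (tail f) (tail g) h h₀≡1 tails k
  where
  tails : tail f ⊛ h ≗ tail g ⊛ h
  tails j = AbelianGroupProperties.∙-cancelˡ ℤ.+-0-abelianGroup (f 0 * h (suc j)) _ _ (trans (p (suc j))
    (cong (λ x → x * h (suc j) + (tail g ⊛ h) j) (sym (⊛-cancelʳ f g h h₀≡1 p 0))))

-- Powers of `q` and the factors 1 - q^i.

q^suc-⊛-zero : ∀ i f → (q^ suc i ⊛ f) 0 ≡ 0ℤ
q^suc-⊛-zero i f = ℤ.*-zeroˡ (f 0)

q^suc-⊛-suc : ∀ i f k → (q^ suc i ⊛ f) (suc k) ≡ (q^ i ⊛ f) k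
q^suc-⊛-suc i f k = trans
  (cong (λ x → x + (q^ i ⊛ f) k) (ℤ.*-zeroˡ (f (suc k))))
  (ℤ.+-identityˡ ((q^ i ⊛ f) k))

1-q^_ : ℕ → Series
1-q^ i = 𝟙 ⊖ q^ i

q^-⊛-1-q^ : ∀ i j → q^ i ⊛ 1-q^ j ≗ q^ i ⊖ q^ (i ℕ.+ j)
q^-⊛-1-q^ zero    j k       = ⊛-identityˡ (1-q^ j) k
q^-⊛-1-q^ (suc i) j zero    = q^suc-⊛-zero i (1-q^ j)
q^-⊛-1-q^ (suc i) j (suc k) = trans (q^suc-⊛-suc i (1-q^ j) k) (q^-⊛-1-q^ i j k)

1-q^-+ : ∀ i j → 1-q^ (i ℕ.+ j) ≗ 1-q^ i ⊕ q^ i ⊛ 1-q^ j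
1-q^-+ i j k = sym (trans
  (cong (_+_ ((1-q^ i) k)) (q^-⊛-1-q^ i j k))
  (telescope (𝟙 k) ((q^ i) k) ((q^ (i ℕ.+ j)) k)))
  where
  telescope : ∀ x y z → (x - y) + (y - z) ≡ x - z
  telescope = solve-∀

-- Recursions of the product formula.

-- The Gaussian binomial (e + d choose d)_q, indexed so that no subtraction occurs.
gaussian : ℕ → ℕ → Series
gaussian e d = ∏ d λ j → quotient (1-q^ (e ℕ.+ suc j)) (1-q^ suc j) refl

gaussian-step : ∀ e d → gaussian e (suc d) ⊛ 1-q^ suc d ≗ gaussian e d ⊛ 1-q^ (e ℕ.+ suc d)
gaussian-step e d = ≗-trans (⊛-assoc (gaussian e d) _ _)
  (⊛-congˡ (quotient-⊛ (1-q^ (e ℕ.+ suc d)) (1-q^ suc d) refl))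

-- Raising `e` moves every numerator exponent up by one, so the numerators telescope: only the
-- lowest old factor and the highest new one survive.
gaussian-suc : ∀ e d → gaussian (suc e) d ⊛ 1-q^ suc e ≗ gaussian e d ⊛ 1-q^ (e ℕ.+ suc d)
gaussian-suc e zero    =
  ⊛-congˡ {x = 𝟙} λ k → cong (λ i → (1-q^ i) k) (ℕ.+-comm 1 e)
gaussian-suc e (suc d) = ⊛-cancelʳ _ _ (1-q^ suc d) refl (begin
  gaussian (suc e) (suc d) ⊛ 1-q^ suc e ⊛ 1-q^ suc d
    ≈⟨ xy∙z≈xz∙y (gaussian (suc e) (suc d)) _ _ ⟩
  gaussian (suc e) (suc d) ⊛ 1-q^ suc d ⊛ 1-q^ suc e
    ≈⟨ ⊛-congʳ (gaussian-step (suc e) d) ⟩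
  gaussian (suc e) d ⊛ 1-q^ (suc e ℕ.+ suc d) ⊛ 1-q^ suc e
    ≈⟨ xy∙z≈xz∙y (gaussian (suc e) d) _ _ ⟩
  gaussian (suc e) d ⊛ 1-q^ suc e ⊛ 1-q^ (suc e ℕ.+ suc d)
    ≈⟨ ⊛-cong (gaussian-suc e d) (λ k → cong (λ i → (1-q^ i) k) (sym (ℕ.+-suc e (suc d)))) ⟩
  gaussian e d ⊛ 1-q^ (e ℕ.+ suc d) ⊛ 1-q^ (e ℕ.+ suc (suc d))
    ≈⟨ ⊛-congʳ (≗-sym (gaussian-step e d)) ⟩
  gaussian e (suc d) ⊛ 1-q^ suc d ⊛ 1-q^ (e ℕ.+ suc (suc d))
    ≈⟨ xy∙z≈xz∙y (gaussian e (suc d)) _ _ ⟩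
  gaussian e (suc d) ⊛ 1-q^ (e ℕ.+ suc (suc d)) ⊛ 1-q^ suc d ∎)
  where open SetoidReasoning (ℕ →-setoid ℤ)

-- For `e = 0` the added factor has equal numerator and denominator.
gaussian-zero : ∀ d → gaussian 0 (suc d) ≗ gaussian 0 d
gaussian-zero d = ⊛-cancelʳ _ _ (1-q^ suc d) refl (gaussian-step 0 d)

-- The top exponent splits as `suc e` plus `suc d`. In the first part `gaussian-suc` and
-- `gaussian-step` trade the factor for `suc e` against the one for `suc d`; the second part already
-- contains the latter, which then cancels.
gaussian-pascal : ∀ e d →
  gaussian (suc e) (suc d) ≗ gaussian e (suc d) ⊕ q^ suc e ⊛ gaussian (suc e) d
gaussian-pascal e d = ⊛-cancelʳ _ _ (1-q^ suc d) refl (begin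
  gaussian (suc e) (suc d) ⊛ 1-q^ suc d
    ≈⟨ gaussian-step (suc e) d ⟩
  gaussian (suc e) d ⊛ 1-q^ (suc e ℕ.+ suc d)
    ≈⟨ ⊛-congˡ (1-q^-+ (suc e) (suc d)) ⟩
  gaussian (suc e) d ⊛ (1-q^ suc e ⊕ q^ suc e ⊛ 1-q^ suc d)
    ≈⟨ ⊛-comm (gaussian (suc e) d) _ ⟩
  (1-q^ suc e ⊕ q^ suc e ⊛ 1-q^ suc d) ⊛ gaussian (suc e) d
    ≈⟨ ⊛-distribʳ-⊕ (gaussian (suc e) d) _ _ ⟩
  1-q^ suc e ⊛ gaussian (suc e) d ⊕ q^ suc e ⊛ 1-q^ suc d ⊛ gaussian (suc e) d
    ≈⟨ (λ k → cong₂ _+_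
         (≗-trans (⊛-comm (1-q^ suc e) _) (≗-trans (gaussian-suc e d) (≗-sym (gaussian-step e d))) k)
         (xy∙z≈xz∙y (q^ suc e) _ _ k)) ⟩
  gaussian e (suc d) ⊛ 1-q^ suc d ⊕ q^ suc e ⊛ gaussian (suc e) d ⊛ 1-q^ suc d
    ≈⟨ ≗-sym (⊛-distribʳ-⊕ (1-q^ suc d) _ _) ⟩
  (gaussian e (suc d) ⊕ q^ suc e ⊛ gaussian (suc e) d) ⊛ 1-q^ suc d ∎)
  where open SetoidReasoning (ℕ →-setoid ℤ)

-- Occurrences of 𝚊𝚋 after prepending a letter.

private variable
  p : Level
  A B : Set
  n a i k : ℕ

module _ {P : Pred B p} (P? : Decidable P) where

  length-filter-map : ∀ (f : A → B) xs →
    length (filter P? (List.map f xs)) ≡ length (filter (P? ∘ f) xs)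
  length-filter-map f []       = refl
  length-filter-map f (x ∷ xs) with does (P? (f x))
  ... | true  = cong suc (length-filter-map f xs)
  ... | false = length-filter-map f xs

  length-filter-++ : ∀ xs ys →
    length (filter P? (xs ++ ys)) ≡ length (filter P? xs) ℕ.+ length (filter P? ys)
  length-filter-++ xs ys =
    trans (cong length (List.filter-++ P? xs ys)) (List.length-++ (filter P? xs))

allFin-suc : ∀ n → allFin (suc n) ≡ zero ∷ List.map suc (allFin n)
allFin-suc n = cong (zero ∷_) (sym (List.map-tabulate (λ i → i) suc))

-- Rows and columns are separate lists so that induction can consume the rows while the columns stay
-- fixed.
occurs-suc : ∀ l (u : Word n) xs ys →
  length (filter (occurs𝚊𝚋? (l ∷ u)) (cartesianProduct (List.map suc xs) (zero ∷ List.map suc ys)))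
    ≡ length (filter (occurs𝚊𝚋? u) (cartesianProduct xs ys))
occurs-suc l u []       ys = refl
occurs-suc l u (x ∷ xs) ys = begin
  -- The pair `(suc x , zero)` is already discarded by computation, since no position precedes
  -- `zero`.
  length (filter (occurs𝚊𝚋? (l ∷ u)) (List.map (suc x ,_) (List.map suc ys) ++ _))
    ≡⟨ length-filter-++ (occurs𝚊𝚋? (l ∷ u)) (List.map (suc x ,_) (List.map suc ys)) _ ⟩
  length (filter (occurs𝚊𝚋? (l ∷ u)) (List.map (suc x ,_) (List.map suc ys))) ℕ.+ _
    ≡⟨ cong₂ ℕ._+_ row (occurs-suc l u xs ys) ⟩
  length (filter (occurs𝚊𝚋? u) (List.map (x ,_) ys)) ℕ.+ _
    ≡⟨ length-filter-++ (occurs𝚊𝚋? u) (List.map (x ,_) ys) _ ⟨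
  length (filter (occurs𝚊𝚋? u) (cartesianProduct (x ∷ xs) ys)) ∎
  where
  open ≡-Reasoning
  row : length (filter (occurs𝚊𝚋? (l ∷ u)) (List.map (suc x ,_) (List.map suc ys)))
      ≡ length (filter (occurs𝚊𝚋? u) (List.map (x ,_) ys))
  row = begin
    length (filter (occurs𝚊𝚋? (l ∷ u)) (List.map (suc x ,_) (List.map suc ys)))
      ≡⟨ cong (length ∘ filter (occurs𝚊𝚋? (l ∷ u))) (List.map-∘ ys) ⟨
    length (filter (occurs𝚊𝚋? (l ∷ u)) (List.map (λ j → suc x , suc j) ys))
      ≡⟨ length-filter-map (occurs𝚊𝚋? (l ∷ u)) (λ j → suc x , suc j) ys ⟩
    length (filter (λ j → occurs𝚊𝚋? (l ∷ u) (suc x , suc j)) ys)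
      ≡⟨ cong length (List.filter-≐ _ _ (map₁ s<s⁻¹ , map₁ s<s) ys) ⟩
    length (filter (λ j → occurs𝚊𝚋? u (x , j)) ys)
      ≡⟨ length-filter-map (occurs𝚊𝚋? u) (x ,_) ys ⟨
    length (filter (occurs𝚊𝚋? u) (List.map (x ,_) ys)) ∎

∣∷∣𝚊𝚋 : ∀ l (u : Word n) →
  ∣ l ∷ u ∣𝚊𝚋 ≡ length (filter (λ j → occurs𝚊𝚋? (l ∷ u) (zero , suc j)) (allFin n)) ℕ.+ ∣ u ∣𝚊𝚋
∣∷∣𝚊𝚋 {n} l u = begin
  length (filter occ? (cartesianProduct (allFin (suc n)) (allFin (suc n))))
    ≡⟨ cong (λ is → length (filter occ? (cartesianProduct is is))) (allFin-suc n) ⟩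
  length (filter occ? (List.map (zero ,_) (List.map suc (allFin n)) ++ _))
    ≡⟨ length-filter-++ occ? (List.map (zero ,_) (List.map suc (allFin n))) _ ⟩
  length (filter occ? (List.map (zero ,_) (List.map suc (allFin n)))) ℕ.+ _
    ≡⟨ cong₂ ℕ._+_ row (occurs-suc l u (allFin n) (allFin n)) ⟩
  length (filter (λ j → occ? (zero , suc j)) (allFin n)) ℕ.+ ∣ u ∣𝚊𝚋 ∎
  where
  open ≡-Reasoning
  occ? = occurs𝚊𝚋? (l ∷ u)
  row : length (filter occ? (List.map (zero ,_) (List.map suc (allFin n))))
      ≡ length (filter (λ j → occ? (zero , suc j)) (allFin n))
  row = trans (length-filter-map occ? (zero ,_) (List.map suc (allFin n)))
              (length-filter-map (occ? ∘ (zero ,_)) suc (allFin n))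

-- Expressed through `∣ u ∣𝚊`, the number of letters 𝚋 is constant over words with a fixed number of
-- letters 𝚊, so a leading 𝚊 shifts all their counts equally.
number-of-𝚋 : ∀ (u : Word n) →
  length (filter (λ j → lookup u j ≟ 𝚋) (allFin n)) ≡ n ∸ ∣ u ∣𝚊
number-of-𝚋 []                = refl
number-of-𝚋 {suc n} (l ∷ u) = trans
  (cong (length ∘ filter (λ j → lookup (l ∷ u) j ≟ 𝚋)) (allFin-suc n)) (go l)
  where
  rest : ∀ l → length (filter (λ j → lookup (l ∷ u) j ≟ 𝚋) (List.map suc (allFin n))) ≡ n ∸ ∣ u ∣𝚊
  rest l = trans (length-filter-map (λ j → lookup (l ∷ u) j ≟ 𝚋) suc (allFin n)) (number-of-𝚋 u)
  go : ∀ l → length (filter (λ j → lookup (l ∷ u) j ≟ 𝚋) (zero ∷ List.map suc (allFin n)))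
           ≡ suc n ∸ ∣ l ∷ u ∣𝚊
  go 𝚊 = rest 𝚊
  -- Truncated subtraction commutes with `suc` here because `∣ u ∣𝚊` is at most `n`.
  go 𝚋 = trans (cong suc (rest 𝚋)) (sym (ℕ.+-∸-assoc 1 (Vec.count≤n (_≟ 𝚊) u)))

∣𝚊∷∣𝚊𝚋 : ∀ (u : Word n) → ∣ 𝚊 ∷ u ∣𝚊𝚋 ≡ (n ∸ ∣ u ∣𝚊) ℕ.+ ∣ u ∣𝚊𝚋
∣𝚊∷∣𝚊𝚋 {n} u = trans (∣∷∣𝚊𝚋 𝚊 u) (cong (ℕ._+ ∣ u ∣𝚊𝚋) (trans
  (cong length (List.filter-≐ _ (λ j → lookup u j ≟ 𝚋)
    ((proj₂ ∘ proj₂) , (λ eq → z<s , refl , eq)) (allFin n)))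
  (number-of-𝚋 u)))

∣𝚋∷∣𝚊𝚋 : ∀ (u : Word n) → ∣ 𝚋 ∷ u ∣𝚊𝚋 ≡ ∣ u ∣𝚊𝚋
∣𝚋∷∣𝚊𝚋 {n} u = trans (∣∷∣𝚊𝚋 𝚋 u) (cong (λ xs → length xs ℕ.+ ∣ u ∣𝚊𝚋)
  (List.filter-none (λ j → occurs𝚊𝚋? (𝚋 ∷ u) (zero , suc j))
    (All.universal (λ { _ (_ , () , _) }) (allFin n))))

-- Enumeration of words by induction on length.

-- The offset `i` records occurrences contributed by a letter already removed; on generating
-- functions it is a factor q^i.
Class : (n a i k : ℕ) → Set
Class n a i k = ∃ λ (u : Word n) → ∣ u ∣𝚊 ≡ a × i ℕ.+ ∣ u ∣𝚊𝚋 ≡ k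

class-≡ : {x y : Class n a i k} → proj₁ x ≡ proj₁ y → x ≡ y
class-≡ {x = u , p , q} {y = .u , p′ , q′} refl =
  cong₂ (λ p q → u , p , q) (ℕ.≡-irrelevant p p′) (ℕ.≡-irrelevant q q′)

Counted : Set → ℤ → Set
Counted A c = ∃ λ m → HasCardinality A m × + m ≡ c

counted-↔ : ∀ {c} → A ↔ B → Counted A c → Counted B c
counted-↔ A↔B (m , Fin↔A , m≡c) = m , ↔-trans Fin↔A A↔B , m≡c

counted-⊎ : ∀ {c d} → Counted A c → Counted B d → Counted (A ⊎ B) (c + d)
counted-⊎ (m , Fin↔A , refl) (n , Fin↔B , refl) =
  m ℕ.+ n , ↔-trans +↔⊎ (Fin↔A ⊎-↔ Fin↔B) , ℤ.pos-+ m n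

counted-empty : ¬ A → Counted A 0ℤ
counted-empty ¬a = 0 , mk↔ₛ′ (λ ()) (λ a → ⊥-elim (¬a a)) (λ a → ⊥-elim (¬a a)) (λ ()) , refl

-- f = Σ_u q^(i + ∣ u ∣𝚊𝚋), over the words u of length n with a letters 𝚊.
Enumerates : (n a i : ℕ) → Series → Set
Enumerates n a i f = ∀ k → Counted (Class n a i k) ([q^ k ] f)

enumerates-cong : ∀ {f g} → f ≗ g → Enumerates n a i f → Enumerates n a i g
enumerates-cong {n} {a} {i} f≗g e k = subst (Counted (Class n a i k)) (f≗g k) (e k)

-- Each unit of offset moves the classes up one degree and leaves degree 0 empty.
enumerates-shift : ∀ {f} i → Enumerates n a 0 f → Enumerates n a i (q^ i ⊛ f)
enumerates-shift {f = f} zero e = enumerates-cong (λ k → sym (⊛-identityˡ f k)) e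
enumerates-shift {f = f} (suc i) e zero =
  subst (Counted _) (sym (q^suc-⊛-zero i f)) (counted-empty λ ())
enumerates-shift {f = f} (suc i) e (suc k) =
  subst (Counted _) (sym (q^suc-⊛-suc i f k)) (counted-↔ shift (enumerates-shift i e k))
  where
  shift : Class n a i k ↔ Class n a (suc i) (suc k)
  shift = mk↔ₛ′
    (λ (u , p , q) → u , p , cong suc q)
    (λ (u , p , q) → u , p , ℕ.suc-injective q)
    (λ _ → class-≡ refl)
    (λ _ → class-≡ refl)

enumerates-empty : n < a → Enumerates n a 0 𝟘
enumerates-empty n<a k = counted-empty λ (u , p , _) →
  ℕ.<⇒≱ n<a (subst (_≤ _) p (Vec.count≤n (_≟ 𝚊) u))

-- The only word without 𝚊 is a power of 𝚋, and it has no occurrence.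
enumerates-zero : ∀ n → Enumerates n 0 0 𝟙
enumerates-zero zero zero = 1 , mk↔ₛ′
  (λ _ → [] , refl , refl)
  (λ _ → Fin.zero)
  (λ { ([] , _) → class-≡ refl })
  (λ { Fin.zero → refl ; (Fin.suc ()) }) , refl
enumerates-zero zero    (suc k) = counted-empty λ { ([] , _ , ()) }
enumerates-zero (suc n) k       = counted-↔ (mk↔ₛ′
  (λ (u , p , q) → 𝚋 ∷ u , p , trans (∣𝚋∷∣𝚊𝚋 u) q)
  (λ { (𝚊 ∷ u , () , _) ; (𝚋 ∷ u , p , q) → u , p , trans (sym (∣𝚋∷∣𝚊𝚋 u)) q })
  (λ { (𝚊 ∷ u , () , _) ; (𝚋 ∷ u , p , q) → class-≡ refl })
  (λ _ → class-≡ refl)) (enumerates-zero n k)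

-- Words are sorted by first letter. What follows a leading 𝚊 has `a` letters 𝚊, hence `n ∸ a`
-- letters 𝚋, which is the offset.
class-suc : ∀ n a k → (Class n (suc a) 0 k ⊎ Class n a (n ∸ a) k) ↔ Class (suc n) (suc a) 0 k
class-suc n a k = mk↔ₛ′ prepend behead
  (λ { (𝚊 ∷ u , p , q) → class-≡ refl ; (𝚋 ∷ u , p , q) → class-≡ refl })
  (λ { (inj₁ _) → cong inj₁ (class-≡ refl) ; (inj₂ _) → cong inj₂ (class-≡ refl) })
  where
  prepend : Class n (suc a) 0 k ⊎ Class n a (n ∸ a) k → Class (suc n) (suc a) 0 k
  prepend (inj₁ (u , p , q)) = 𝚋 ∷ u , p , trans (∣𝚋∷∣𝚊𝚋 u) q
  prepend (inj₂ (u , p , q)) = 𝚊 ∷ u , cong suc p ,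
    trans (∣𝚊∷∣𝚊𝚋 u) (trans (cong (λ x → n ∸ x ℕ.+ ∣ u ∣𝚊𝚋) p) q)
  behead : Class (suc n) (suc a) 0 k → Class n (suc a) 0 k ⊎ Class n a (n ∸ a) k
  behead (𝚊 ∷ u , p , q) = inj₂ (u , ℕ.suc-injective p ,
    trans (cong (λ x → n ∸ x ℕ.+ ∣ u ∣𝚊𝚋) (sym (ℕ.suc-injective p))) (trans (sym (∣𝚊∷∣𝚊𝚋 u)) q))
  behead (𝚋 ∷ u , p , q) = inj₁ (u , p , trans (sym (∣𝚋∷∣𝚊𝚋 u)) q)

enumerates-suc : ∀ {f g} → Enumerates n (suc a) 0 f → Enumerates n a 0 g →
  Enumerates (suc n) (suc a) 0 (f ⊕ q^ (n ∸ a) ⊛ g)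
enumerates-suc {n} {a} e e′ k =
  counted-↔ (class-suc n a k) (counted-⊎ (e k) (enumerates-shift (n ∸ a) e′ k))

enumerates-gaussian : ∀ n a → a ≤ n → Enumerates n a 0 (gaussian (n ∸ a) a)
enumerates-gaussian n       zero    _     = enumerates-zero n
enumerates-gaussian (suc n) (suc a) a≤n with ℕ.m≤n⇒m<n∨m≡n (s≤s⁻¹ a≤n)
... | inj₁ a<n = enumerates-cong pascal
  (enumerates-suc (enumerates-gaussian n (suc a) a<n) (enumerates-gaussian n a (s≤s⁻¹ a≤n)))
  where
  pascal : gaussian (n ∸ suc a) (suc a) ⊕ q^ (n ∸ a) ⊛ gaussian (n ∸ a) a ≗ gaussian (n ∸ a) (suc a)
  -- Since `a < n`, the exponent `n ∸ a` is the successor of `n ∸ suc a`, as `gaussian-pascal`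
  -- requires.
  pascal rewrite ℕ.+-∸-assoc 1 a<n = ≗-sym (gaussian-pascal (n ∸ suc a) a)
-- For `a = n` no word of length `n` has `suc n` letters 𝚊, so the leading-𝚋 summand is `𝟘`, and the
-- shift exponent is 0.
... | inj₂ refl = enumerates-cong diagonal
  (enumerates-suc (enumerates-empty ℕ.≤-refl) (enumerates-gaussian n n ℕ.≤-refl))
  where
  diagonal : 𝟘 ⊕ q^ (n ∸ n) ⊛ gaussian (n ∸ n) n ≗ gaussian (n ∸ n) (suc n)
  diagonal k rewrite ℕ.n∸n≡0 n = trans (ℤ.+-identityˡ _)
    (trans (⊛-identityˡ (gaussian 0 n) k) (sym (gaussian-zero n k)))

corollary5 : (n : ℕ) (w : Word n) → ∃ λ m → HasCardinality [ w ]∼₂ m × + m ≡ [q^ ∣ w ∣𝚊𝚋 ] gaussianBinomial n ∣ w ∣𝚊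
-- By unfolding, the class of `w` is a `Class` with offset 0, and `gaussianBinomial n a` is
-- `gaussian (n ∸ a) a`.
corollary5 n w = enumerates-gaussian n ∣ w ∣𝚊 (Vec.count≤n (_≟ 𝚊) w) ∣ w ∣𝚊𝚋
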